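{- Let $k\ge 1$ be an integer and let $(P_{k,n})_{n\ge0}$ be the generalized $k$-Pell-Tribonacci sequence. For every integer $n\geq 0$, $$\sum_{i=0}^{n}P_{k,i}=\frac{P_{k,n+3}+(1-2k)P_{k,n+2}+(1-3k)P_{k,n+1}-1}{3k}.$$
   Context: For an integer $k\geq 1$, the generalized $k$-Pell-Tribonacci sequence $(P_{k,n})_{n\ge 0}$ is defined by $P_{k,0}=0$, $P_{k,1}=1$, $P_{k,2}=2k$ and $P_{k,n}=2kP_{k,n-1}+kP_{k,n-2}+P_{k,n-3}$ for $n\geq 3$. -}

module Defs where

open import Data.Integer using (ℤ; +_; 0ℤ; 1ℤ; _+_; _*_)
open import Data.Integer.Properties using (+-0-commutativeMonoid)
open import Data.Nat using (ℕ; zero; suc)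
open import Algebra.Properties.CommutativeMonoid.Sum +-0-commutativeMonoid public using (sum; sum⁺-syntax)

P : ℕ → ℕ → ℤ
P k 0 = 0ℤ
P k 1 = 1ℤ
P k 2 = + 2 * + k
P k (suc (suc (suc n))) = + 2 * + k * P k (suc (suc n)) + + k * P k (suc n) + P k n

{-# OPTIONS --safe #-}
-- Since 2k + k + 1 − 1 = 3k, the recurrence makes the numerator on the right grow by exactly
-- 3k P k (n + 1) when n increases by one, so 3k times the sum telescopes.
module Submission where

open import Algebra.Properties.CommutativeMonoid.Sum using (sum-init-last; sum-cong-≗)
open import Data.Nat as ℕ using (ℕ; NonZero; zero; suc)
open import Data.Nat.Properties using (m*n≢0; +-comm)
open import Data.Integer using (ℤ; +_; 0ℤ; 1ℤ; _+_; _*_; _-_)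
open import Data.Integer.Properties using (+-0-commutativeMonoid; *-identityʳ; *-distribʳ-+; pos-*)
open import Data.Integer.Tactic.RingSolver using (solve-∀)
open import Data.Rational using (_/_)
open import Data.Rational.Properties using (fromℚᵘ-cong)
open import Data.Rational.Unnormalised using (mkℚᵘ; *≡*)
open import Data.Fin using (toℕ)
open import Data.Fin.Properties using (toℕ-fromℕ; toℕ-inject₁)
open import Relation.Binary.PropositionalEquality using (_≡_; cong; cong₂; sym; trans; module ≡-Reasoning)
open import Defs

-- Multiplied by 3k, the claim lives in ℤ and goes by induction on n. Both sides vanish at n = 0
-- (`numerator-zero`), and both grow by 3k P k (n + 1) at each step (`numerator-suc`). Rationals
-- enter only at the end, through `/-cross`.

-- Cross-multiplication is what equality of unnormalised fractions means, and normalising respects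
-- it.
/-cross : ∀ (p q : ℤ) (m n : ℕ) .{{_ : NonZero m}} .{{_ : NonZero n}} →
          p * + n ≡ q * + m → p / m ≡ q / n
/-cross p q (suc m) (suc n) eq = fromℚᵘ-cong {mkℚᵘ p m} {mkℚᵘ q n} (*≡* eq)

-- `sum` recurses from the first term, while the induction needs the last one split off.
∑≤-suc : ∀ (f : ℕ → ℤ) n → ∑[ i ≤ suc n ] f (toℕ i) ≡ ∑[ i ≤ n ] f (toℕ i) + f (suc n)
∑≤-suc f n = trans
  (sum-init-last +-0-commutativeMonoid {suc n} (λ i → f (toℕ i)))
  (cong₂ _+_ (sum-cong-≗ +-0-commutativeMonoid {suc n} (λ i → cong f (toℕ-inject₁ i)))
             (cong f (toℕ-fromℕ (suc n))))

-- The offsets stand on the left of `n` so that the recurrence for `P` unfolds by computation.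
numerator : ℕ → ℕ → ℤ
numerator k n = P k (3 ℕ.+ n) + (1ℤ - + 2 * + k) * P k (2 ℕ.+ n) + (1ℤ - + 3 * + k) * P k (1 ℕ.+ n) - 1ℤ

numerator-zero : ∀ k → numerator k 0 ≡ 0ℤ
numerator-zero k = identity (+ k)
  where
  identity : ∀ x → + 2 * x * (+ 2 * x) + x * 1ℤ + 0ℤ + (1ℤ - + 2 * x) * (+ 2 * x) + (1ℤ - + 3 * x) * 1ℤ - 1ℤ ≡ 0ℤ
  identity = solve-∀

-- Once the recurrence expands P k (n + 4), the terms in `a` and `b` cancel in the difference, and
-- `c` is left with 1 - (1 - 3k) = 3k.
numerator-suc : ∀ k n → numerator k (suc n) ≡ numerator k n + P k (suc n) * (+ 3 * + k)
numerator-suc k n = identity (+ k) (P k (3 ℕ.+ n)) (P k (2 ℕ.+ n)) (P k (1 ℕ.+ n))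
  where
  identity : ∀ x a b c →
    + 2 * x * a + x * b + c + (1ℤ - + 2 * x) * a + (1ℤ - + 3 * x) * b - 1ℤ
    ≡ a + (1ℤ - + 2 * x) * b + (1ℤ - + 3 * x) * c - 1ℤ + c * (+ 3 * x)
  identity = solve-∀

∑P*3k≡numerator : ∀ k n → (∑[ i ≤ n ] P k (toℕ i)) * (+ 3 * + k) ≡ numerator k n
-- The left side computes to `0ℤ`, its only summand being P k 0 = 0.
∑P*3k≡numerator k zero    = sym (numerator-zero k)
∑P*3k≡numerator k (suc n) = begin
  (∑[ i ≤ suc n ] P k (toℕ i)) * (+ 3 * + k)                        ≡⟨ cong (_* (+ 3 * + k)) (∑≤-suc (P k) n) ⟩
  (∑[ i ≤ n ] P k (toℕ i) + P k (suc n)) * (+ 3 * + k)              ≡⟨ *-distribʳ-+ (+ 3 * + k) (∑[ i ≤ n ] P k (toℕ i)) _ ⟩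
  (∑[ i ≤ n ] P k (toℕ i)) * (+ 3 * + k) + P k (suc n) * (+ 3 * + k) ≡⟨ cong (_+ P k (suc n) * (+ 3 * + k)) (∑P*3k≡numerator k n) ⟩
  numerator k n + P k (suc n) * (+ 3 * + k)                         ≡⟨ numerator-suc k n ⟨
  numerator k (suc n)                                               ∎
  where open ≡-Reasoning

proposition2 : ∀ (k : ℕ) .{{_ : NonZero k}} (n : ℕ) →
    let instance _ = m*n≢0 3 k in
    (∑[ i ≤ n ] P k (toℕ i)) / 1
    ≡ (P k (n ℕ.+ 3) + (1ℤ - + 2 * + k) * P k (n ℕ.+ 2) + (1ℤ - + 3 * + k) * P k (n ℕ.+ 1) - 1ℤ) / (3 ℕ.* k)
proposition2 k n rewrite +-comm n 3 | +-comm n 2 | +-comm n 1 =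
  /-cross (∑[ i ≤ n ] P k (toℕ i)) (numerator k n) 1 (3 ℕ.* k) {{_}} {{m*n≢0 3 k}} (begin
    (∑[ i ≤ n ] P k (toℕ i)) * + (3 ℕ.* k)  ≡⟨ cong ((∑[ i ≤ n ] P k (toℕ i)) *_) (pos-* 3 k) ⟩
    (∑[ i ≤ n ] P k (toℕ i)) * (+ 3 * + k)  ≡⟨ ∑P*3k≡numerator k n ⟩
    -- The factor `1ℤ` is the denominator of the sum viewed as a fraction.
    numerator k n                           ≡⟨ *-identityʳ (numerator k n) ⟨
    numerator k n * 1ℤ                      ∎)
  where open ≡-Reasoning
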